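{- Let $\mathbb K=(K,\oplus,\otimes,\mathbf 0,\mathbf 1)$ be a commutative semiring and let $\mathcal O^{\mathbb K}=\langle\mathcal O,\lambda\rangle$ be a $\mathbb K$-annotated $\mathcal{ELHI}^n_\bot$ ontology. The following claims hold. (i) For each model $\mathcal I$ of $\mathcal O$, there exists a model $\mathcal I^{\mathbb K}$ of $\mathcal O^{\mathbb K}$ such that $\mathcal I$ and $\mathcal I^{\mathbb K}$ coincide on their non-annotated part. (ii) For each model $\mathcal I^{\mathbb K}$ of $\mathcal O^{\mathbb K}$, there exists a model $\mathcal I$ of $\mathcal O$ such that $\mathcal I$ and $\mathcal I^{\mathbb K}$ coincide on their non-annotated part.
   Context: Syntax. Let $\mathsf{N_C},\mathsf{N_R},\mathsf{N_I}$ be mutually disjoint countable sets of concept, role and individual names. A role $P$ is a role name $R\in\mathsf{N_R}$ or an inverse role $R^-$. Concepts: $C::=A\mid\exists P.C\mid C\sqcap C\mid\top$ ($A\in\mathsf{N_C}$); $\exists P$ abbreviates $\exists P.\top$. $\mathcal{ELHI}^n_\bot$ axioms: assertions $A(a)$, $R(a,b)$; GCIs $C\sqsubseteq D$ with $C::=A\mid\exists P.C\mid C\sqcap C\mid\top$ and $D::=A\mid\exists P.\top\mid\bot$; role inclusions $P\sqsubseteq Q$ (positive) and $P\sqcap Q\sqsubseteq\bot$ (negative). An ontology is a finite set of axioms. Classical semantics. Interpretations have a nonempty domain $\Delta^{\mathcal I}$, map individual names to elements, concept names to subsets and role names to binary relations; complex expressions are interpreted in the usual way ($\top$ as the domain,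 $\bot$ as $\emptyset$, $R^-$ as the converse relation, $(\exists P.C)^{\mathcal I}=\{d\mid\exists e\in C^{\mathcal I},(d,e)\in P^{\mathcal I}\}$, $\sqcap$ as intersection), inclusions as set inclusions, assertions as membership. A model satisfies all axioms. Annotated semantics. A $\mathbb K$-annotated ontology is a pair $\langle\mathcal O,\lambda\rangle$ with $\lambda:\mathcal O\to K\setminus\{\mathbf 0\}$, identified with the set of annotated axioms $(\alpha,\lambda(\alpha))$, $\alpha\in\mathcal O$. A $\mathbb K$-annotated interpretation $\mathcal I$ has a nonempty domain $\Delta^{\mathcal I}$ and maps $a\in\mathsf{N_I}$ to $a^{\mathcal I}\in\Delta^{\mathcal I}$, $A\in\mathsf{N_C}$ to $A^{\mathcal I}\subseteq\Delta^{\mathcal I}\times K$, $R\in\mathsf{N_R}$ to $R^{\mathcal I}\subseteq\Delta^{\mathcal I}\times\Delta^{\mathcal I}\times K$, with $\top^{\mathcal I}=\Delta^{\mathcal I}\times\{\mathbf 1\}$, $\bot^{\mathcal I}=\emptyset$, $(R^-)^{\mathcal I}=\{(e,d,\kappa)\mid(d,e,\kappa)\in R^{\mathcal I}\}$, $(\exists P.C)^{\mathcal I}=\{(d,\kappa\otimes\kappa')\mid\exists e:(d,e,\kappa)\in P^{\mathcal I},(e,\kappa')\in C^{\mathcal I}\}$, $(C\sqcap D)^{\mathcal I}=\{(d,\kappa\otimes\kappa')\mid(d,\kappa)\in C^{\mathcal I},(d,\kappa')\in D^{\mathcal I}\}$, $(P\sqcap Q)^{\mathcal I}=\{(d,e,\kappa\otimes\kappa')\mid(d,e,\kappa)\in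 P^{\mathcal I},(d,e,\kappa')\in Q^{\mathcal I}\}$. $\mathcal I$ satisfies $(C\sqsubseteq D,\kappa)$ if $(d,\kappa')\in C^{\mathcal I}$ implies $(d,\kappa\otimes\kappa')\in D^{\mathcal I}$ for all $d,\kappa'$; $(P\sqsubseteq Q,\kappa)$ if $(d,e,\kappa')\in P^{\mathcal I}$ implies $(d,e,\kappa\otimes\kappa')\in Q^{\mathcal I}$ for all $d,e,\kappa'$; $(P\sqcap Q\sqsubseteq\bot,\kappa)$ if $(P\sqcap Q)^{\mathcal I}=\emptyset$; $(A(a),\kappa)$ if $(a^{\mathcal I},\kappa)\in A^{\mathcal I}$; $(R(a,b),\kappa)$ if $(a^{\mathcal I},b^{\mathcal I},\kappa)\in R^{\mathcal I}$. $\mathcal I$ is a model of $\mathcal O^{\mathbb K}$ if it satisfies all its annotated axioms. A classical interpretation $\mathcal I$ and a $\mathbb K$-annotated interpretation $\mathcal I^{\mathbb K}$ coincide on their non-annotated part iff: they have the same domain; $a^{\mathcal I}=a^{\mathcal I^{\mathbb K}}$ for all $a\in\mathsf{N_I}$; for all $A\in\mathsf{N_C}$ and $d$, $d\in A^{\mathcal I}$ iff there is $\kappa\in K$ with $(d,\kappa)\in A^{\mathcal I^{\mathbb K}}$; for all $R\in\mathsf{N_R}$ and $d,e$, $(d,e)\in R^{\mathcal I}$ iff there is $\kappa\in K$ with $(d,e,\kappa)\in R^{\mathcal I^{\mathbb K}}$. -}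

module Defs where

open import Level using (Level; _⊔_; suc; Lift)
open import Algebra.Bundles using (CommutativeSemiring)
open import Data.Empty.Polymorphic using () renaming (⊥ to ⊥ₚ)
open import Data.Unit.Polymorphic using () renaming (⊤ to ⊤ₚ)
open import Data.List.Base using (List)
open import Data.List.Membership.Propositional using (_∈_)
open import Data.List.Relation.Unary.Unique.Propositional using (Unique)
open import Data.Nat.Base using (ℕ)
open import Data.Product.Base using (Σ-syntax; ∃-syntax; _×_; proj₁)
open import Function.Base using (id)
open import Function.Bundles using (_↣_; _⇔_)
open import Relation.Binary.Core using (Rel)
open import Relation.Binary.PropositionalEquality.Core using (_≡_; subst)
open import Relation.Nullary.Negation.Core using (¬_)
open import Relation.Unary using (Pred)

-- The three sets of names are disjoint because they are separate types;
-- an injection into ℕ makes each of them countable (possibly finite).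
record Signature : Set₁ where
  field
    NC NR NI     : Set
    NC-countable : NC ↣ ℕ
    NR-countable : NR ↣ ℕ
    NI-countable : NI ↣ ℕ

module _ (S : Signature) where
  open Signature S

  data Role : Set where
    name : NR → Role
    inv  : NR → Role

  infixr 7 _⊓_

  data Concept : Set where
    atom : NC → Concept
    some : Role → Concept → Concept
    _⊓_  : Concept → Concept → Concept
    top  : Concept

  -- Right-hand sides of GCIs; some⊤ P is ∃P.⊤.
  data RHS : Set where
    atom  : NC → RHS
    some⊤ : Role → RHS
    bot   : RHS

  infix 4 _⊑_ _⊑ʳ_ _⊓_⊑⊥

  data Axiom : Set where
    conceptAssertion : NC → NI → Axiom
    roleAssertion    : NR → NI → NI → Axiom
    _⊑_              : Concept → RHS → Axiom
    _⊑ʳ_             : Role → Role → Axiom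
    _⊓_⊑⊥            : Role → Role → Axiom

  -- A finite set of axioms is a duplicate-free list, so that a function on
  -- membership proofs is a function on the set.
  record Ontology : Set where
    field
      axioms : List Axiom
      unique : Unique axioms

  record Interpretation (u : Level) : Set (suc u) where
    field
      Δ        : Set u
      nonempty : Δ
      indᴵ     : NI → Δ
      conᴵ     : NC → Pred Δ u
      roleᴵ    : NR → Rel Δ u

  module _ {c ℓ} (o : Level) (K : CommutativeSemiring c ℓ) where
    open CommutativeSemiring K using (Carrier; _≈_)

    -- Subsets of Δ × K and Δ × Δ × K are predicates closed under the equality
    -- _≈_ of the semiring.  The universe of the domain and of these predicates
    -- includes those of K, so that a quantifier over K stays within it.
    record AnnotatedInterpretation : Set (suc (c ⊔ ℓ ⊔ o)) where
      field
        Δ          : Set (c ⊔ ℓ ⊔ o)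
        nonempty   : Δ
        indᴵ       : NI → Δ
        conᴵ       : NC → Δ → Pred Carrier (c ⊔ ℓ ⊔ o)
        roleᴵ      : NR → Δ → Δ → Pred Carrier (c ⊔ ℓ ⊔ o)
        conᴵ-resp  : ∀ A {d κ κ′} → κ ≈ κ′ → conᴵ A d κ → conᴵ A d κ′
        roleᴵ-resp : ∀ R {d e κ κ′} → κ ≈ κ′ → roleᴵ R d e κ → roleᴵ R d e κ′

  record AnnotatedOntology {c ℓ} (K : CommutativeSemiring c ℓ) : Set (c ⊔ ℓ) where
    open CommutativeSemiring K using (Carrier; _≉_; 0#)
    field
      ontology : Ontology
    open Ontology ontology public
    field
      label : ∀ {α} → α ∈ axioms → Σ[ κ ∈ Carrier ] κ ≉ 0#

module ClassicalSemantics {S : Signature} {u} (I : Interpretation S u) where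
  open Interpretation I

  ⟦_⟧ʳ : Role S → Rel Δ u
  ⟦ name R ⟧ʳ d e = roleᴵ R d e
  ⟦ inv R ⟧ʳ  d e = roleᴵ R e d

  ⟦_⟧ : Concept S → Pred Δ u
  ⟦ atom A ⟧   d = conᴵ A d
  ⟦ some P C ⟧ d = ∃[ e ] (⟦ C ⟧ e × ⟦ P ⟧ʳ d e)
  ⟦ C ⊓ D ⟧    d = ⟦ C ⟧ d × ⟦ D ⟧ d
  ⟦ top ⟧      d = ⊤ₚ

  ⟦_⟧ᴿ : RHS S → Pred Δ u
  ⟦ atom A ⟧ᴿ    = ⟦ atom A ⟧
  ⟦ some⊤ P ⟧ᴿ   = ⟦ some P top ⟧
  ⟦ bot ⟧ᴿ     d = ⊥ₚ

  Satisfies : Axiom S → Set u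
  Satisfies (conceptAssertion A a) = conᴵ A (indᴵ a)
  Satisfies (roleAssertion R a b)  = roleᴵ R (indᴵ a) (indᴵ b)
  Satisfies (C ⊑ D)                = ∀ d → ⟦ C ⟧ d → ⟦ D ⟧ᴿ d
  Satisfies (P ⊑ʳ Q)               = ∀ d e → ⟦ P ⟧ʳ d e → ⟦ Q ⟧ʳ d e
  Satisfies (P ⊓ Q ⊑⊥)             = ∀ d e → ¬ (⟦ P ⟧ʳ d e × ⟦ Q ⟧ʳ d e)

module AnnotatedSemantics {S : Signature} {c ℓ o} {K : CommutativeSemiring c ℓ}
                          (I : AnnotatedInterpretation S o K) where
  open CommutativeSemiring K using (Carrier; _≈_; 1#) renaming (_*_ to _⊗_)
  open AnnotatedInterpretation I

  -- In this module μ stands for the annotation of a tuple in the interpreted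
  -- expression: a set { (x , κ ⊗ κ′) | … } is { (x , μ) | μ ≈ κ ⊗ κ′ , … }.

  ⟦_⟧ʳ : Role S → Δ → Δ → Pred Carrier (c ⊔ ℓ ⊔ o)
  ⟦ name R ⟧ʳ d e μ = roleᴵ R d e μ
  ⟦ inv R ⟧ʳ  d e μ = roleᴵ R e d μ

  ⟦_∩_⟧ʳ : Role S → Role S → Δ → Δ → Pred Carrier (c ⊔ ℓ ⊔ o)
  ⟦ P ∩ Q ⟧ʳ d e μ =
    ∃[ κ ] ∃[ κ′ ] (μ ≈ κ ⊗ κ′ × ⟦ P ⟧ʳ d e κ × ⟦ Q ⟧ʳ d e κ′)

  ⟦_⟧ : Concept S → Δ → Pred Carrier (c ⊔ ℓ ⊔ o)
  ⟦ atom A ⟧   d μ = conᴵ A d μ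
  ⟦ some P C ⟧ d μ =
    ∃[ κ ] ∃[ κ′ ] (μ ≈ κ ⊗ κ′ × ∃[ e ] (⟦ P ⟧ʳ d e κ × ⟦ C ⟧ e κ′))
  ⟦ C ⊓ D ⟧    d μ =
    ∃[ κ ] ∃[ κ′ ] (μ ≈ κ ⊗ κ′ × ⟦ C ⟧ d κ × ⟦ D ⟧ d κ′)
  ⟦ top ⟧      d μ = Lift (c ⊔ ℓ ⊔ o) (μ ≈ 1#)

  ⟦_⟧ᴿ : RHS S → Δ → Pred Carrier (c ⊔ ℓ ⊔ o)
  ⟦ atom A ⟧ᴿ      = ⟦ atom A ⟧
  ⟦ some⊤ P ⟧ᴿ     = ⟦ some P top ⟧
  ⟦ bot ⟧ᴿ     d μ = ⊥ₚ

  Satisfies : Axiom S → Carrier → Set (c ⊔ ℓ ⊔ o)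
  Satisfies (conceptAssertion A a) κ = conᴵ A (indᴵ a) κ
  Satisfies (roleAssertion R a b)  κ = roleᴵ R (indᴵ a) (indᴵ b) κ
  Satisfies (C ⊑ D)                κ = ∀ d κ′ → ⟦ C ⟧ d κ′ → ⟦ D ⟧ᴿ d (κ ⊗ κ′)
  Satisfies (P ⊑ʳ Q)               κ =
    ∀ d e κ′ → ⟦ P ⟧ʳ d e κ′ → ⟦ Q ⟧ʳ d e (κ ⊗ κ′)
  Satisfies (P ⊓ Q ⊑⊥)             κ = ∀ d e μ → ¬ ⟦ P ∩ Q ⟧ʳ d e μ

infix 4 _⊨_ _⊨ᴷ_

_⊨_ : ∀ {S u} → Interpretation S u → Ontology S → Set u
I ⊨ O = ∀ {α} → α ∈ Ontology.axioms O → ClassicalSemantics.Satisfies I α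

_⊨ᴷ_ : ∀ {S c ℓ o} {K : CommutativeSemiring c ℓ} →
       AnnotatedInterpretation S o K → AnnotatedOntology S K → Set (c ⊔ ℓ ⊔ o)
I ⊨ᴷ O = ∀ {α} (α∈O : α ∈ axioms) →
         AnnotatedSemantics.Satisfies I α (proj₁ (label α∈O))
  where open AnnotatedOntology O

-- Coincidence on the non-annotated part; `to` transports elements along the
-- equality of the two domains.
record Coincide {S : Signature} {c ℓ o} {K : CommutativeSemiring c ℓ}
                (I : Interpretation S (c ⊔ ℓ ⊔ o))
                (Iᴷ : AnnotatedInterpretation S o K) : Set (suc (c ⊔ ℓ ⊔ o)) where
  private
    module I  = Interpretation I
    module Iᴷ = AnnotatedInterpretation Iᴷ
  field
    sameDomain : I.Δ ≡ Iᴷ.Δ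

  to : I.Δ → Iᴷ.Δ
  to = subst id sameDomain

  field
    sameInd  : ∀ a → to (I.indᴵ a) ≡ Iᴷ.indᴵ a
    sameCon  : ∀ A d → I.conᴵ A d ⇔ (∃[ κ ] Iᴷ.conᴵ A (to d) κ)
    sameRole : ∀ R d e → I.roleᴵ R d e ⇔ (∃[ κ ] Iᴷ.roleᴵ R (to d) (to e) κ)

{-# OPTIONS --safe #-}

-- (i) Annotate every tuple of a classical model with all elements of K at once;
-- (ii) forget the annotations.  In both directions an annotated concept or role
-- has some annotation at a tuple exactly when its classical counterpart holds.

module Submission where

open import Defs
open import Level using (Level; _⊔_; lift)
open import Algebra.Bundles using (CommutativeSemiring)
open import Data.Product.Base using (Σ-syntax; ∃-syntax; _×_; _,_; proj₁)
open import Data.Unit.Polymorphic using (tt)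
open import Function.Base using (id)
open import Function.Bundles using (mk⇔)
open import Function.Construct.Identity using (⇔-id)
open import Relation.Binary.PropositionalEquality.Core using (refl)

module Saturation {S : Signature} {c ℓ} (o : Level) (K : CommutativeSemiring c ℓ)
                  (I : Interpretation S (c ⊔ ℓ ⊔ o)) where
  open CommutativeSemiring K using (Carrier; 1#; *-identityʳ) renaming (_*_ to _⊗_; sym to ≈-sym; refl to ≈-refl)
  open Interpretation I

  saturate : AnnotatedInterpretation S o K
  saturate = record
    { Δ          = Δ
    ; nonempty   = nonempty
    ; indᴵ       = indᴵ
    ; conᴵ       = λ A d _ → conᴵ A d
    ; roleᴵ      = λ R d e _ → roleᴵ R d e
    -- The predicates ignore the annotation, so closure under `≈` is the identity.
    ; conᴵ-resp  = λ _ _ → id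
    ; roleᴵ-resp = λ _ _ → id
    }

  private
    module C = ClassicalSemantics I
    module A = AnnotatedSemantics saturate

  role⇒classical : ∀ P {d e κ} → A.⟦ P ⟧ʳ d e κ → C.⟦ P ⟧ʳ d e
  role⇒classical (name R) r = r
  role⇒classical (inv R)  r = r

  role⇒annotated : ∀ P {d e} κ → C.⟦ P ⟧ʳ d e → A.⟦ P ⟧ʳ d e κ
  role⇒annotated (name R) κ r = r
  role⇒annotated (inv R)  κ r = r

  -- Serves the left-hand sides of GCIs. A converse at every `κ` would in general fail at `top`,
  -- whose only annotation is `1#`.
  concept⇒classical : ∀ C {d κ} → A.⟦ C ⟧ d κ → C.⟦ C ⟧ d
  concept⇒classical (atom A)   x = x
  concept⇒classical (some P C) (_ , _ , _ , e , r , x) =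
    e , concept⇒classical C x , role⇒classical P r
  concept⇒classical (C ⊓ D)    (_ , _ , _ , x , y) =
    concept⇒classical C x , concept⇒classical D y
  concept⇒classical top        _ = tt

  -- Atoms carry every annotation by saturation. For `some⊤ P` the role edge absorbs all of `κ`,
  -- which leaves `1#` for `top`. The case `bot` is vacuous.
  rhs⇒annotated : ∀ D {d} κ → C.⟦ D ⟧ᴿ d → A.⟦ D ⟧ᴿ d κ
  rhs⇒annotated (atom A)  κ x = x
  rhs⇒annotated (some⊤ P) κ (e , _ , r) =
    κ , 1# , ≈-sym (*-identityʳ κ) , e , role⇒annotated P κ r , lift ≈-refl

  satisfies : ∀ α κ → C.Satisfies α → A.Satisfies α κ
  satisfies (conceptAssertion A a) κ s = s
  satisfies (roleAssertion R a b)  κ s = s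
  -- Drop `κ′` on the left, apply the classical inclusion, then choose `κ ⊗ κ′` among the
  -- annotations available on the right.
  satisfies (C ⊑ D)  κ s d κ′ x = rhs⇒annotated D (κ ⊗ κ′) (s d (concept⇒classical C x))
  satisfies (P ⊑ʳ Q) κ s d e κ′ r = role⇒annotated Q (κ ⊗ κ′) (s d e (role⇒classical P r))
  satisfies (P ⊓ Q ⊑⊥) κ s d e μ (_ , _ , _ , p , q) =
    s d e (role⇒classical P p , role⇒classical Q q)

  coincide : Coincide I saturate
  coincide = record
    { sameDomain = refl
    ; sameInd    = λ _ → refl
    -- Any element of the semiring would serve as witness; `1#` shows that one exists.
    ; sameCon    = λ _ _ → mk⇔ (1# ,_) λ (_ , x) → x
    ; sameRole   = λ _ _ _ → mk⇔ (1# ,_) λ (_ , r) → r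
    }

module Forgetting {S : Signature} {c ℓ o} {K : CommutativeSemiring c ℓ}
                  (Iᴷ : AnnotatedInterpretation S o K) where
  open CommutativeSemiring K using (1#) renaming (_*_ to _⊗_; refl to ≈-refl)
  open AnnotatedInterpretation Iᴷ

  forget : Interpretation S (c ⊔ ℓ ⊔ o)
  forget = record
    { Δ        = Δ
    ; nonempty = nonempty
    ; indᴵ     = indᴵ
    ; conᴵ     = λ A d → ∃[ κ ] conᴵ A d κ
    ; roleᴵ    = λ R d e → ∃[ κ ] roleᴵ R d e κ
    }

  private
    module C = ClassicalSemantics forget
    module A = AnnotatedSemantics Iᴷ

  role⇒classical : ∀ P {d e κ} → A.⟦ P ⟧ʳ d e κ → C.⟦ P ⟧ʳ d e
  role⇒classical (name R) r = _ , r
  role⇒classical (inv R)  r = _ , r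

  role⇒annotated : ∀ P {d e} → C.⟦ P ⟧ʳ d e → ∃[ κ ] A.⟦ P ⟧ʳ d e κ
  role⇒annotated (name R) r = r
  role⇒annotated (inv R)  r = r

  -- In an arbitrary annotated model the annotation cannot be prescribed, only found: multiply those
  -- of the components, starting from `1#` at `top`.
  concept⇒annotated : ∀ C {d} → C.⟦ C ⟧ d → ∃[ κ ] A.⟦ C ⟧ d κ
  concept⇒annotated (atom A)   x = x
  concept⇒annotated (some P C) (e , x , r) =
    let κ  , r′ = role⇒annotated P r
        κ′ , x′ = concept⇒annotated C x
    in κ ⊗ κ′ , κ , κ′ , ≈-refl , e , r′ , x′
  concept⇒annotated (C ⊓ D)    (x , y) =
    let κ  , x′ = concept⇒annotated C x
        κ′ , y′ = concept⇒annotated D y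
    in κ ⊗ κ′ , κ , κ′ , ≈-refl , x′ , y′
  concept⇒annotated top        _ = 1# , lift ≈-refl

  rhs⇒classical : ∀ D {d κ} → A.⟦ D ⟧ᴿ d κ → C.⟦ D ⟧ᴿ d
  rhs⇒classical (atom A)  x = _ , x
  rhs⇒classical (some⊤ P) (_ , _ , _ , e , r , _) = e , tt , role⇒classical P r

  satisfies : ∀ α κ → A.Satisfies α κ → C.Satisfies α
  satisfies (conceptAssertion A a) κ s = κ , s
  satisfies (roleAssertion R a b)  κ s = κ , s
  satisfies (C ⊑ D)  κ s d x =
    -- One annotation `κ′` on the left is enough: the annotated GCI yields `κ ⊗ κ′` on the right,
    -- which is then forgotten.
    let κ′ , x′ = concept⇒annotated C x in rhs⇒classical D (s d κ′ x′)
  satisfies (P ⊑ʳ Q) κ s d e r =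
    let κ′ , r′ = role⇒annotated P r in role⇒classical Q (s d e κ′ r′)
  satisfies (P ⊓ Q ⊑⊥) κ s d e (p , q) =
    let κ₁ , p′ = role⇒annotated P p
        κ₂ , q′ = role⇒annotated Q q
    -- A classical overlap puts `κ₁ ⊗ κ₂` into the annotated intersection. This contradicts its
    -- emptiness even when the product is zero.
    in s d e (κ₁ ⊗ κ₂) (κ₁ , κ₂ , ≈-refl , p′ , q′)

  coincide : Coincide forget Iᴷ
  coincide = record
    { sameDomain = refl
    ; sameInd    = λ _ → refl
    -- `forget` interprets names by exactly the existential that coincidence asks for.
    ; sameCon    = λ _ _ → ⇔-id _
    ; sameRole   = λ _ _ _ → ⇔-id _
    }

lemma3p8 : ∀ {c ℓ} (o : Level) (S : Signature) (K : CommutativeSemiring c ℓ)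
    (Oᴷ : AnnotatedOntology S K) →
    let O = AnnotatedOntology.ontology Oᴷ in
    ((I : Interpretation S (c ⊔ ℓ ⊔ o)) → I ⊨ O →
    Σ[ Iᴷ ∈ AnnotatedInterpretation S o K ] (Iᴷ ⊨ᴷ Oᴷ × Coincide I Iᴷ))
    ×
    ((Iᴷ : AnnotatedInterpretation S o K) → Iᴷ ⊨ᴷ Oᴷ →
    Σ[ I ∈ Interpretation S (c ⊔ ℓ ⊔ o) ] (I ⊨ O × Coincide I Iᴷ))
lemma3p8 o S K Oᴷ =
  (λ I I⊨O → let open Saturation o K I in
    saturate , (λ {α} α∈O → satisfies α (proj₁ (label α∈O)) (I⊨O α∈O)) , coincide) ,
  (λ Iᴷ Iᴷ⊨O → let open Forgetting Iᴷ in
    forget , (λ {α} α∈O → satisfies α (proj₁ (label α∈O)) (Iᴷ⊨O α∈O)) , coincide)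
  where open AnnotatedOntology Oᴷ using (label)
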